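{- Let $\mathbf{C}$ be a small category with countably many arrows, $O$ a set of observations and $T$ an inference system. Then the category $\mathbf{Coalg}_{\mathbf{S}_T}$ of saturated coalgebras has a final object.
   Context: Composition is written in diagrammatic order: $f;g$ means first $f$, then $g$. $|\mathbf{C}|$ is the set of objects and $\|\mathbf{C}\|$ the set of arrows of $\mathbf{C}$. A $\Gamma(\mathbf{C})$-algebra $\mathbb{X}$ is a family of sets $X=(X_i)_{i\in|\mathbf{C}|}$ with a function $c_{\mathbb{X}}:X_i\to X_j$ for every $c\in\mathbf{C}[i,j]$ such that $(id_i)_{\mathbb{X}}=id_{X_i}$ and $(d;e)_{\mathbb{X}}(x)=e_{\mathbb{X}}(d_{\mathbb{X}}(x))$ (i.e. a functor $\mathbf{C}\to\mathbf{Set}$). Homomorphisms are natural transformations; the category is $\mathbf{Alg}_{\Gamma(\mathbf{C})}$. $\int X=\sum_{i}X_i$. $\mathbf{G}(X)_i$ is the set of (at most) countable subsets of $\sum_{j\in|\mathbf{C}|}\mathbf{C}[i,j]\times O\times\int X$. An inference system $T$ is a set of rules $c\xrightarrow[o']{o}d$ with $c\in\mathbf{C}[i,i']$, $d\in\mathbf{C}[j,j']$, $o,o'\in O$. $\Phi(T)$ is the closure of $T$ together with all identity rules $id_i\xrightarrow[o]{o}id_j$ ($i,j\in|\mathbf{C}|$, $o\in O$) under: $c\xrightarrow[o']{o}c'$ and $d\xrightarrow[o'']{o'}d'$ give $c;d\xrightarrow[o'']{o}c';d'$ whenever $c;d$ and $c';d'$ are defined. For $d\in\mathbf{C}[i,k]$,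 $c_1$ of source $i$ and $c_2$ of source $k$, write $(c_1,o_1,q_1)\vdash^{d}_{T,\mathbb{X}}(c_2,o_2,q_2)$ iff there are $e,e'\in\|\mathbf{C}\|$ with $c_1;e=d;c_2$, $e\xrightarrow[o_2]{o_1}e'\in\Phi(T)$ and $e'_{\mathbb{X}}(q_1)=q_2$. Write $\vdash_{T,\mathbb{X}}$ for $\vdash^{id}_{T,\mathbb{X}}$. $A\in\mathbf{G}(X)_i$ is saturated if closed under $\vdash_{T,\mathbb{X}}$. The endofunctor $\mathbf{S}_T$ of $\mathbf{Alg}_{\Gamma(\mathbf{C})}$ maps $\mathbb{X}$ to the algebra whose carrier of sort $i$ is the set of saturated sets in $\mathbf{G}(X)_i$, with $d_{\mathbf{S}_T(\mathbb{X})}(A)=\{t_2\mid \exists t_1\in A,\ t_1\vdash^{d}_{T,\mathbb{X}}t_2\}$; on arrows $\mathbf{S}_T(h)(A)=\{(c,o,h(x))\mid(c,o,x)\in A\}$. An $\mathbf{S}_T$-coalgebra is $\langle\mathbb{X},\alpha:\mathbb{X}\to\mathbf{S}_T(\mathbb{X})\rangle$; morphisms $\langle\mathbb{X},\alpha\rangle\to\langle\mathbb{Y},\beta\rangle$ are homomorphisms $f$ with $\alpha;\mathbf{S}_T(f)=f;\beta$. -}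

module Defs where

open import Level using (Level; _⊔_; suc)
open import Data.Nat.Base as ℕ using (ℕ)
import Data.Nat.Properties as ℕ
open import Data.Product.Base using (Σ; Σ-syntax; ∃; ∃₂; _×_; _,_; proj₁; proj₂)
open import Data.Product.Relation.Binary.Pointwise.NonDependent using (_×ₛ_)
open import Function.Base using (_∘_)
open import Function.Bundles using (Func; _⇔_; mk⇔; Equivalence)
import Function.Construct.Composition as Comp
import Function.Construct.Identity as Id
open import Relation.Binary.Bundles using (Setoid)
open import Relation.Binary.Structures using (IsEquivalence)
open import Relation.Binary.PropositionalEquality.Core as ≡ using (_≡_)
open import Relation.Nullary.Negation using (contradiction)

private
  variable
    a b δ o h e o′ h′ e′ : Level

-- Sets are setoids throughout: hom-sets, the set of observations and the
-- carriers of algebras carry an equivalence relation.  Objects are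
-- compared with _≡_.  Composition _⨟_ is diagrammatic.

record Category (o h e : Level) : Set (suc (o ⊔ h ⊔ e)) where
  infix  4 _≈_
  infixr 4 _⇒_
  infixr 9 _⨟_
  field
    Obj     : Set o
    _⇒_     : Obj → Obj → Set h
    _≈_     : ∀ {i j} → i ⇒ j → i ⇒ j → Set e
    isEquiv : ∀ {i j} → IsEquivalence (_≈_ {i} {j})
    id      : ∀ i → i ⇒ i
    _⨟_     : ∀ {i j k} → i ⇒ j → j ⇒ k → i ⇒ k
    ⨟-cong  : ∀ {i j k} {c c′ : i ⇒ j} {d d′ : j ⇒ k} →
              c ≈ c′ → d ≈ d′ → c ⨟ d ≈ c′ ⨟ d′
    idˡ     : ∀ {i j} (c : i ⇒ j) → id i ⨟ c ≈ c
    idʳ     : ∀ {i j} (c : i ⇒ j) → c ⨟ id j ≈ c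
    assoc   : ∀ {i j k l} (c : i ⇒ j) (d : j ⇒ k) (f : k ⇒ l) →
              (c ⨟ d) ⨟ f ≈ c ⨟ (d ⨟ f)

  hom : Obj → Obj → Setoid h e
  hom i j = record { isEquivalence = isEquiv {i} {j} }

  module Hom {i j} = Setoid (hom i j)

record Functor (C : Category o h e) (D : Category o′ h′ e′) :
               Set (o ⊔ h ⊔ e ⊔ o′ ⊔ h′ ⊔ e′) where
  private
    module C = Category C
    module D = Category D
  field
    F₀     : C.Obj → D.Obj
    F₁     : ∀ {x y} → x C.⇒ y → F₀ x D.⇒ F₀ y
    F-cong : ∀ {x y} {f g : x C.⇒ y} → f C.≈ g → F₁ f D.≈ F₁ g
    F-id   : ∀ x → F₁ (C.id x) D.≈ D.id (F₀ x)
    F-⨟    : ∀ {x y z} (f : x C.⇒ y) (g : y C.⇒ z) →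
             F₁ (f C.⨟ g) D.≈ F₁ f D.⨟ F₁ g

record FinalObject (C : Category o h e) : Set (o ⊔ h ⊔ e) where
  open Category C
  field
    final    : Obj
    !        : ∀ x → x ⇒ final
    !-unique : ∀ {x} (f : x ⇒ final) → f ≈ ! x

module _ {C : Category o h e} (F : Functor C C) where
  open Category C
  open Functor F

  record Coalgebra : Set (o ⊔ h) where
    field
      carrier   : Obj
      structure : carrier ⇒ F₀ carrier

  open Coalgebra

  record CoalgebraHom (X Y : Coalgebra) : Set (h ⊔ e) where
    field
      arrow    : carrier X ⇒ carrier Y
      commutes : structure X ⨟ F₁ arrow ≈ arrow ⨟ structure Y

  open CoalgebraHom

  Coalg : Category (o ⊔ h) (h ⊔ e) e
  Coalg = record
    { Obj     = Coalgebra
    ; _⇒_     = CoalgebraHom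
    ; _≈_     = λ f g → arrow f ≈ arrow g
    ; isEquiv = record { refl = Hom.refl ; sym = Hom.sym ; trans = Hom.trans }
    ; id      = λ X → record
      { arrow    = id (carrier X)
      ; commutes = Hom.trans (⨟-cong Hom.refl (F-id (carrier X)))
                     (Hom.trans (idʳ _) (Hom.sym (idˡ _)))
      }
    ; _⨟_     = λ f g → record
      { arrow    = arrow f ⨟ arrow g
      ; commutes =
          Hom.trans (⨟-cong Hom.refl (F-⨟ (arrow f) (arrow g)))
          (Hom.trans (Hom.sym (assoc _ _ _))
          (Hom.trans (⨟-cong (commutes f) Hom.refl)
          (Hom.trans (assoc _ _ _)
          (Hom.trans (⨟-cong Hom.refl (commutes g))
          (Hom.sym (assoc _ _ _))))))
      }
    ; ⨟-cong  = ⨟-cong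
    ; idˡ     = λ f → idˡ (arrow f)
    ; idʳ     = λ f → idʳ (arrow f)
    ; assoc   = λ f g k → assoc (arrow f) (arrow g) (arrow k)
    }

module _ {I : Set o} (S : I → Setoid a b) where
  private module S {i} = Setoid (S i)

  data ∑-Eq : Σ I (λ i → S.Carrier {i}) → Σ I (λ i → S.Carrier {i}) →
              Set (o ⊔ a ⊔ b) where
    inj : ∀ {i} {x y : S.Carrier {i}} → x S.≈ y → ∑-Eq (i , x) (i , y)

  ∑ : Setoid (o ⊔ a) (o ⊔ a ⊔ b)
  ∑ = record
    { Carrier       = Σ I (λ i → S.Carrier {i})
    ; _≈_           = ∑-Eq
    ; isEquivalence = record
      { refl  = inj S.refl
      ; sym   = λ { (inj p) → inj (S.sym p) }
      ; trans = λ { (inj p) (inj q) → inj (S.trans p q) }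
      }
    }

-- An at most countable subset is given as the range of a partial function
-- on ℕ: `elt n p` is its value at n, defined when Dom n is inhabited, and
-- `elt-irr` makes it single-valued.  Only the range matters, since _≐_
-- below is equality of subsets.  (Dom need not be decidable, so finite
-- and empty subsets are included and subsets of countable sets are
-- countable without appeal to excluded middle.)

record CountableSubset (S : Setoid a b) (δ : Level) : Set (a ⊔ b ⊔ suc δ) where
  open Setoid S
  field
    Dom     : ℕ → Set δ
    elt     : ∀ n → Dom n → Carrier
    elt-irr : ∀ n (p q : Dom n) → elt n p ≈ elt n q

module _ {S : Setoid a b} {δ : Level} where
  open Setoid S
  open CountableSubset

  infix 4 _∈_ _≐_

  _∈_ : Carrier → CountableSubset S δ → Set (b ⊔ δ)
  x ∈ A = ∃₂ λ n (p : Dom A n) → elt A n p ≈ x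

  _≐_ : CountableSubset S δ → CountableSubset S δ → Set (a ⊔ b ⊔ δ)
  A ≐ B = ∀ x → x ∈ A ⇔ x ∈ B

  ∈-resp : ∀ (A : CountableSubset S δ) {x y} → x ≈ y → x ∈ A → y ∈ A
  ∈-resp A x≈y (n , p , eq) = n , p , trans eq x≈y

  ∈-elt : ∀ (A : CountableSubset S δ) n (p : Dom A n) → elt A n p ∈ A
  ∈-elt A n p = n , p , refl

image : {S : Setoid a b} {S′ : Setoid o e} →
        Func S S′ → CountableSubset S δ → CountableSubset S′ δ
image f A = record
  { Dom     = Dom
  ; elt     = λ n p → Func.to f (elt n p)
  ; elt-irr = λ n p q → Func.cong f (elt-irr n p q)
  }
  where open CountableSubset A

∈-image : {S : Setoid a b} {S′ : Setoid o e} (f : Func S S′)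
          (A : CountableSubset S δ) (y : Setoid.Carrier S′) →
          y ∈ image f A ⇔ (∃ λ x → x ∈ A × Setoid._≈_ S′ (Func.to f x) y)
∈-image {S = S} {S′} f A y = mk⇔
  (λ { (n , p , eq) → elt n p , (n , p , Setoid.refl S) , eq })
  (λ { (x , (n , p , eq) , fx≈y) →
       n , p , Setoid.trans S′ (Func.cong f eq) fx≈y })
  where open CountableSubset A

IsCountable : Setoid a b → (δ : Level) → Set (a ⊔ b ⊔ suc δ)
IsCountable S δ = Σ[ A ∈ CountableSubset S δ ] (∀ x → x ∈ A)

-- pair n m = 2ⁿ(2m + 1).
pair : ℕ → ℕ → ℕ
pair ℕ.zero    m = ℕ.suc (2 ℕ.* m)
pair (ℕ.suc n) m = 2 ℕ.* pair n m

pair-injective : ∀ n n′ {m m′} → pair n m ≡ pair n′ m′ → n ≡ n′ × m ≡ m′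
pair-injective ℕ.zero ℕ.zero eq =
  ≡.refl , ℕ.*-cancelˡ-≡ _ _ 2 (ℕ.suc-injective eq)
pair-injective ℕ.zero (ℕ.suc n′) {m} {m′} eq =
  contradiction (≡.sym eq) (ℕ.even≢odd (pair n′ m′) m)
pair-injective (ℕ.suc n) ℕ.zero {m} {m′} eq =
  contradiction eq (ℕ.even≢odd (pair n m) m′)
pair-injective (ℕ.suc n) (ℕ.suc n′) eq
  with pair-injective n n′ (ℕ.*-cancelˡ-≡ _ _ 2 eq)
... | ≡.refl , eq′ = ≡.refl , eq′

-- C and O live in the universe ℓ.  The carriers of algebras live in suc ℓ,
-- which is closed under forming the set of countable subsets (those have
-- Dom : ℕ → Set ℓ), so that S below is an endofunctor.

module _ {ℓ : Level} (C : Category ℓ ℓ ℓ) where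
  private module C = Category C

  arrows : Setoid ℓ ℓ
  arrows = ∑ {I = C.Obj} λ i → ∑ {I = C.Obj} λ j → C.hom i j

  CountablyManyArrows : Set (suc ℓ)
  CountablyManyArrows = IsCountable arrows ℓ

  record Algebra : Set (suc (suc ℓ)) where
    field
      sort : C.Obj → Setoid (suc ℓ) (suc ℓ)
      op   : ∀ {i j} → i C.⇒ j → Func (sort i) (sort j)

    El : C.Obj → Set (suc ℓ)
    El i = Setoid.Carrier (sort i)

    module Sort {i} = Setoid (sort i)

    infixl 8 _·_
    _·_ : ∀ {i j} → El i → i C.⇒ j → El j
    x · c = Func.to (op c) x

    field
      op-cong : ∀ {i j} {c c′ : i C.⇒ j} → c C.≈ c′ →
                ∀ x → x · c Sort.≈ x · c′
      op-id   : ∀ {i} (x : El i) → x · C.id i Sort.≈ x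
      op-⨟    : ∀ {i j k} (d : i C.⇒ j) (f : j C.⇒ k) (x : El i) →
                x · (d C.⨟ f) Sort.≈ x · d · f

    ∫ : Setoid (suc ℓ) (suc ℓ)
    ∫ = ∑ sort

  record Homomorphism (X Y : Algebra) : Set (suc ℓ) where
    private
      module X = Algebra X
      module Y = Algebra Y
    field
      func : ∀ i → Func (X.sort i) (Y.sort i)

    ⟦_⟧ : ∀ {i} → X.El i → Y.El i
    ⟦_⟧ {i} = Func.to (func i)

    field
      natural : ∀ {i j} (c : i C.⇒ j) (x : X.El i) →
                ⟦ x X.· c ⟧ Y.Sort.≈ ⟦ x ⟧ Y.· c

  open Homomorphism using (func; natural; ⟦_⟧)

  Alg : Category (suc (suc ℓ)) (suc ℓ) (suc ℓ)
  Alg = record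
    { Obj     = Algebra
    ; _⇒_     = Homomorphism
    ; _≈_     = λ {X} {Y} f g → ∀ i (x : Algebra.El X i) →
                  Algebra.Sort._≈_ Y (⟦ f ⟧ x) (⟦ g ⟧ x)
    ; isEquiv = λ {X} {Y} → record
      { refl  = λ i x → Algebra.Sort.refl Y
      ; sym   = λ p i x → Algebra.Sort.sym Y (p i x)
      ; trans = λ p q i x → Algebra.Sort.trans Y (p i x) (q i x)
      }
    ; id      = λ X → record
      { func    = λ i → Id.function (Algebra.sort X i)
      ; natural = λ c x → Algebra.Sort.refl X
      }
    ; _⨟_     = λ {X} {Y} {Z} f g → record
      { func    = λ i → Comp.function (func f i) (func g i)
      ; natural = λ c x → Algebra.Sort.trans Z
                    (Func.cong (func g _) (natural f c x))
                    (natural g c (⟦ f ⟧ x))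
      }
    ; ⨟-cong  = λ {X} {Y} {Z} {f} {f′} {g} {g′} p q i x →
                  Algebra.Sort.trans Z
                    (Func.cong (func g i) (p i x)) (q i (⟦ f′ ⟧ x))
    ; idˡ     = λ {X} {Y} f i x → Algebra.Sort.refl Y
    ; idʳ     = λ {X} {Y} f i x → Algebra.Sort.refl Y
    ; assoc   = λ {W} {X} {Y} {Z} f g k i x → Algebra.Sort.refl Z
    }

module _ {ℓ : Level} (C : Category ℓ ℓ ℓ) (O : Setoid ℓ ℓ) where
  open Category C
  private module O = Setoid O

  -- T c o o′ d is the rule  c --o/o′--> d  (o above, o′ below the arrow).
  InferenceSystem : Set (suc ℓ)
  InferenceSystem = ∀ {i i′ j j′} →
    i ⇒ i′ → O.Carrier → O.Carrier → j ⇒ j′ → Set ℓ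

  -- `resp` only says that Φ(T) is a subset of a product of setoids.
  data Φ (T : InferenceSystem) : ∀ {i i′ j j′} →
         i ⇒ i′ → O.Carrier → O.Carrier → j ⇒ j′ → Set ℓ where
    rule     : ∀ {i i′ j j′} {c : i ⇒ i′} {o o′} {d : j ⇒ j′} →
               T c o o′ d → Φ T c o o′ d
    identity : ∀ i j o → Φ T (id i) o o (id j)
    compose  : ∀ {i i′ i″ j j′ j″} {c : i ⇒ i′} {d : i′ ⇒ i″}
               {c′ : j ⇒ j′} {d′ : j′ ⇒ j″} {o o′ o″} →
               Φ T c o o′ c′ → Φ T d o′ o″ d′ →
               Φ T (c ⨟ d) o o″ (c′ ⨟ d′)
    resp     : ∀ {i i′ j j′} {c c′ : i ⇒ i′} {d d′ : j ⇒ j′} {o₁ o₁′ o₂ o₂′} →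
               c ≈ c′ → o₁ O.≈ o₁′ → o₂ O.≈ o₂′ → d ≈ d′ →
               Φ T c o₁ o₂ d → Φ T c′ o₁′ o₂′ d′

module _ {ℓ : Level} (C : Category ℓ ℓ ℓ) (O : Setoid ℓ ℓ)
         (T : InferenceSystem C O) where
  open Category C
  private module O = Setoid O

  module _ (X : Algebra C) where
    open Algebra X

    -- In (j , c , o , k , x), c has type i ⇒ j and x has sort k.
    triples : Obj → Setoid (suc ℓ) (suc ℓ)
    triples i = ∑ λ j → hom i j ×ₛ (O ×ₛ ∫)

    Triple : Obj → Set (suc ℓ)
    Triple i = Setoid.Carrier (triples i)

    infix 4 _⊢[_]_ _⊢_

    -- The equation c₁;e = d;c₂ fixes the source and target of e, and
    -- e′(q₁) = q₂ those of e′.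
    _⊢[_]_ : ∀ {i k} → Triple i → i ⇒ k → Triple k → Set (suc ℓ)
    (a , c₁ , o₁ , j , q₁) ⊢[ d ] (b , c₂ , o₂ , j′ , q₂) =
      Σ[ e ∈ a ⇒ b ] Σ[ e′ ∈ j ⇒ j′ ]
        c₁ ⨟ e ≈ d ⨟ c₂ × Φ C O T e o₁ o₂ e′ × q₁ · e′ Sort.≈ q₂

    _⊢_ : ∀ {i} → Triple i → Triple i → Set (suc ℓ)
    t₁ ⊢ t₂ = t₁ ⊢[ id _ ] t₂

    G : Obj → Set (suc ℓ)
    G i = CountableSubset (triples i) ℓ

    record Saturated (i : Obj) : Set (suc ℓ) where
      field
        set    : G i
        closed : ∀ {t₁ t₂} → t₁ ∈ set → t₁ ⊢ t₂ → t₂ ∈ set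

    open Saturated

    saturatedSetoid : Obj → Setoid (suc ℓ) (suc ℓ)
    saturatedSetoid i = record
      { Carrier       = Saturated i
      ; _≈_           = λ A B → set A ≐ set B
      ; isEquivalence = record
        { refl  = λ t → mk⇔ (λ p → p) (λ p → p)
        ; sym   = λ A≐B t → mk⇔ (from (A≐B t)) (to (A≐B t))
        ; trans = λ A≐B B≐D t →
            mk⇔ (to (B≐D t) ∘ to (A≐B t)) (from (A≐B t) ∘ from (B≐D t))
        }
      }
      where open Equivalence using (to; from)

    ⊢-trans : ∀ {i k} {d : i ⇒ k} {t₁ t₂ t₃} →
              t₁ ⊢[ d ] t₂ → t₂ ⊢ t₃ → t₁ ⊢[ d ] t₃
    ⊢-trans (e , e′ , eq , φ , p) (f , f′ , eq′ , ψ , q) =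
      e ⨟ f , e′ ⨟ f′ ,
      Hom.trans (Hom.sym (assoc _ _ _))
        (Hom.trans (⨟-cong eq Hom.refl)
        (Hom.trans (assoc _ _ _) (⨟-cong Hom.refl (Hom.trans eq′ (idˡ _))))) ,
      compose φ ψ ,
      Sort.trans (op-⨟ e′ f′ _) (Sort.trans (Func.cong (op f′) p) q)

    ⊢-resp : ∀ {i k} {d d′ : i ⇒ k} {t₁ t₂} → d ≈ d′ →
             t₁ ⊢[ d ] t₂ → t₁ ⊢[ d′ ] t₂
    ⊢-resp d≈d′ (e , e′ , eq , φ , p) =
      e , e′ , Hom.trans eq (⨟-cong d≈d′ Hom.refl) , φ , p

    -- (d;c,o,q) ⊢ᵈ (c,o,q), by the rule id --o/o--> id.
    ⊢-cancel : ∀ {i k a} {d : i ⇒ k} {c : i ⇒ a} {c′ : k ⇒ a} {o j q} →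
               c ≈ d ⨟ c′ → (a , c , o , j , q) ⊢[ d ] (a , c′ , o , j , q)
    ⊢-cancel eq =
      id _ , id _ , Hom.trans (idʳ _) eq , identity _ _ _ , op-id _

  module _ (countable : CountablyManyArrows C) where
    private
      module Arr = CountableSubset (proj₁ countable)

    -- The set {t₂ | ∃ t₁ ∈ A, t₁ ⊢ᵈ t₂} is countable.  As A is saturated, it
    -- equals {(c₂,o,q) | (d;c₂,o,q) ∈ A}, which is enumerated by pairing an
    -- enumeration of A with one of the arrows of C.
    transition : (X : Algebra C) → ∀ {i k} (d : i ⇒ k) (A : Saturated X i) →
      Σ[ B ∈ G X k ] (∀ t₂ →
        t₂ ∈ B ⇔ (∃ λ t₁ → t₁ ∈ Saturated.set A × _⊢[_]_ X t₁ d t₂))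
    transition X {i} {k} d A = B , λ t₂ → mk⇔ (sound t₂) (complete t₂)
      where
      open Algebra X
      open Saturated A
      module A = CountableSubset set

      Cofactor : Triple X i → Setoid.Carrier (arrows C) → Set ℓ
      Cofactor (a , c , _) f =
        Σ[ c₂ ∈ k ⇒ a ] Setoid._≈_ (arrows C) f (k , a , c₂) × c ≈ d ⨟ c₂

      quotient : ∀ t f → Cofactor t f → Triple X k
      quotient (a , _ , oq) _ (c₂ , _) = a , c₂ , oq

      quotient-irr : ∀ {t t′ f f′} → Setoid._≈_ (triples X i) t t′ →
        Setoid._≈_ (arrows C) f f′ →
        (p : Cofactor t f) (q : Cofactor t′ f′) →
        Setoid._≈_ (triples X k) (quotient t f p) (quotient t′ f′ q)
      quotient-irr (inj (_ , r)) f≈f′ (c₂ , u , _) (c₂′ , v , _)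
        with Setoid.trans (arrows C) (Setoid.sym (arrows C) u)
               (Setoid.trans (arrows C) f≈f′ v)
      ... | inj (inj c₂≈c₂′) = inj (c₂≈c₂′ , r)

      Index : ℕ → Set ℓ
      Index N = Σ[ n ∈ ℕ ] Σ[ m ∈ ℕ ] pair n m ≡ N ×
        (Σ[ p ∈ A.Dom n ] Σ[ r ∈ Arr.Dom m ] Cofactor (A.elt n p) (Arr.elt m r))

      B : G X k
      B = record
        { Dom     = Index
        ; elt     = λ { N (n , m , _ , p , r , s) →
                        quotient (A.elt n p) (Arr.elt m r) s }
        ; elt-irr = irr
        }
        where
        irr : ∀ N (x y : Index N) → _
        irr N (n , m , eq , p , r , s) (n′ , m′ , eq′ , p′ , r′ , s′)
          with pair-injective n n′ (≡.trans eq (≡.sym eq′))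
        ... | ≡.refl , ≡.refl =
          quotient-irr (A.elt-irr n p p′) (Arr.elt-irr m r r′) s s′

      sound : ∀ t₂ → t₂ ∈ B → ∃ λ t₁ → t₁ ∈ set × _⊢[_]_ X t₁ d t₂
      sound (a , c₂ , o , j , q) (_ , (n , m , _ , p , r , s) , eq) =
        lemma (A.elt n p) (∈-elt set n p) s eq
        where
        lemma : ∀ t {f} → t ∈ set → (s : Cofactor t f) →
          Setoid._≈_ (triples X k) (quotient t f s) (a , c₂ , o , j , q) →
          ∃ λ t₁ → t₁ ∈ set × _⊢[_]_ X t₁ d (a , c₂ , o , j , q)
        lemma t t∈A (c₂′ , _ , c≈dc₂′) (inj (c₂′≈c₂ , o′≈o , inj q′≈q)) =
          (a , d ⨟ c₂ , o , j , q) ,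
          ∈-resp set
            (inj (Hom.trans c≈dc₂′ (⨟-cong Hom.refl c₂′≈c₂) , o′≈o , inj q′≈q))
            t∈A ,
          ⊢-cancel X Hom.refl

      complete : ∀ t₂ → (∃ λ t₁ → t₁ ∈ set × _⊢[_]_ X t₁ d t₂) → t₂ ∈ B
      complete (a , c₂ , o , j , q) (_ , t₁∈A , e , e′ , eq , φ , r)
        with closed {t₂ = a , d ⨟ c₂ , o , j , q} t₁∈A
               (e , e′ , Hom.trans eq (Hom.sym (idˡ _)) , φ , r)
           | proj₂ countable (k , a , c₂)
      ... | n , p , u | m , r′ , v =
        let s , w = cofactor (A.elt n p) u
        in pair n m , (n , m , ≡.refl , p , r′ , s) , w
        where
        cofactor : ∀ t → Setoid._≈_ (triples X i) t (a , d ⨟ c₂ , o , j , q) →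
          Σ[ s ∈ Cofactor t (Arr.elt m r′) ]
            Setoid._≈_ (triples X k) (quotient t _ s) (a , c₂ , o , j , q)
        cofactor _ (inj (c≈ , oq)) = (c₂ , v , c≈) , inj (Hom.refl , oq)

    module _ (X : Algebra C) where
      open Algebra X
      open Saturated
      open Equivalence using (to; from)

      act : ∀ {i k} → i ⇒ k → Saturated X i → Saturated X k
      act d A = record
        { set    = proj₁ (transition X d A)
        ; closed = λ {t₁} {t₂} t₁∈ t₁⊢t₂ →
            let t , t∈A , t⊢t₁ = to (proj₂ (transition X d A) t₁) t₁∈
            in from (proj₂ (transition X d A) t₂)
                 (t , t∈A , ⊢-trans X t⊢t₁ t₁⊢t₂)
        }

      ∈-act : ∀ {i k} (d : i ⇒ k) (A : Saturated X i) t₂ →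
        t₂ ∈ set (act d A) ⇔ (∃ λ t₁ → t₁ ∈ set A × _⊢[_]_ X t₁ d t₂)
      ∈-act d A = proj₂ (transition X d A)

      act-mono : ∀ {i k} {d d′ : i ⇒ k} {A B : Saturated X i} → d ≈ d′ →
        (∀ t → t ∈ set A → t ∈ set B) →
        ∀ t → t ∈ set (act d A) → t ∈ set (act d′ B)
      act-mono {d = d} {d′} {A} {B} d≈d′ A⊆B t t∈ =
        let t₁ , t₁∈A , st = to (∈-act d A t) t∈
        in from (∈-act d′ B t) (t₁ , A⊆B t₁ t₁∈A , ⊢-resp X d≈d′ st)

      act-⨟ : ∀ {i j k} (d : i ⇒ j) (f : j ⇒ k) (A : Saturated X i) →
        set (act (d ⨟ f) A) ≐ set (act f (act d A))
      act-⨟ d f A t@(a , c , o , j , q) = mk⇔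
        (λ t∈ →
          let t₁ , t₁∈A , e , e′ , eq , φ , r = to (∈-act (d ⨟ f) A t) t∈
              t′ = a , f ⨟ c , o , j , q
          in from (∈-act f (act d A) t)
               (t′ ,
                from (∈-act d A t′)
                  (t₁ , t₁∈A , e , e′ , Hom.trans eq (assoc _ _ _) , φ , r) ,
                ⊢-cancel X Hom.refl))
        (λ t∈ →
          let t′ , t′∈ , g , g′ , eq′ , ψ , r′ = to (∈-act f (act d A) t) t∈
              t₁ , t₁∈A , e , e′ , eq , φ , r  = to (∈-act d A t′) t′∈
          in from (∈-act (d ⨟ f) A t)
               (t₁ , t₁∈A , e ⨟ g , e′ ⨟ g′ ,
                Hom.trans (Hom.sym (assoc _ _ _))
                  (Hom.trans (⨟-cong eq Hom.refl)
                  (Hom.trans (assoc _ _ _)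
                  (Hom.trans (⨟-cong Hom.refl eq′) (Hom.sym (assoc _ _ _))))) ,
                compose φ ψ ,
                Sort.trans (op-⨟ e′ g′ _)
                  (Sort.trans (Func.cong (op g′) r) r′)))

      saturatedAlgebra : Algebra C
      saturatedAlgebra = record
        { sort    = saturatedSetoid X
        ; op      = λ d → record
          { to   = act d
          ; cong = λ {A} {B} A≐B t → mk⇔
              (act-mono {A = A} {B} Hom.refl (λ t → to (A≐B t)) t)
              (act-mono {A = B} {A} Hom.refl (λ t → from (A≐B t)) t)
          }
        ; op-cong = λ c≈c′ A t → mk⇔
            (act-mono {A = A} {A} c≈c′ (λ _ p → p) t)
            (act-mono {A = A} {A} (Hom.sym c≈c′) (λ _ p → p) t)
        ; op-id   = λ {i} A t → mk⇔
            (λ t∈ → let t₁ , t₁∈A , st = to (∈-act (id i) A t) t∈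
                    in closed A t₁∈A st)
            (λ t∈A → from (∈-act (id i) A t)
                       (t , t∈A , ⊢-cancel X (Hom.sym (idˡ _))))
        ; op-⨟    = act-⨟
        }

    module _ {X Y : Algebra C} (f : Homomorphism C X Y) where
      private
        module X = Algebra X
        module Y = Algebra Y
      open Homomorphism f
      open Saturated
      open Equivalence using (to; from)

      mapTriple : ∀ i → Func (triples X i) (triples Y i)
      mapTriple i = record
        { to   = λ { (a , c , o , k , x) → a , c , o , k , ⟦ x ⟧ }
        ; cong = λ { (inj (c≈ , o≈ , inj x≈)) →
                     inj (c≈ , o≈ , inj (Func.cong (func _) x≈)) }
        }

      mapTriple-⊢ : ∀ {i k} {d : i ⇒ k} {t₁ t₂} → _⊢[_]_ X t₁ d t₂ →
        _⊢[_]_ Y (Func.to (mapTriple i) t₁) d (Func.to (mapTriple k) t₂)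
      mapTriple-⊢ (e , e′ , eq , φ , r) =
        e , e′ , eq , φ ,
        Y.Sort.trans (Y.Sort.sym (natural e′ _)) (Func.cong (func _) r)

      -- Transitions out of the image of f lift along f.
      mapTriple-lift : ∀ {i k} {d : i ⇒ k} {t t₁ t₂} →
        Setoid._≈_ (triples Y i) (Func.to (mapTriple i) t) t₁ →
        _⊢[_]_ Y t₁ d t₂ →
        ∃ λ t′ → _⊢[_]_ X t d t′ ×
          Setoid._≈_ (triples Y k) (Func.to (mapTriple k) t′) t₂
      mapTriple-lift {t = a , c , o , j , x} {t₂ = b , c₂ , o₂ , j′ , y}
        (inj (c≈ , o≈ , inj x≈)) (e , e′ , eq , φ , r) =
        (b , c₂ , o₂ , j′ , x X.· e′) ,
        (e , e′ , Hom.trans (⨟-cong c≈ Hom.refl) eq ,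
         resp Hom.refl (O.sym o≈) O.refl Hom.refl φ , X.Sort.refl) ,
        inj (Hom.refl , O.refl ,
             inj (Y.Sort.trans (natural e′ x)
                   (Y.Sort.trans (Func.cong (Y.op e′) x≈) r)))

      saturatedImage : ∀ {i} → Saturated X i → Saturated Y i
      saturatedImage {i} A = record
        { set    = image (mapTriple i) (set A)
        ; closed = λ {t₁} {t₂} t₁∈ t₁⊢t₂ →
            let t , t∈A , ft≈t₁  = to (∈-image (mapTriple i) (set A) t₁) t₁∈
                t′ , st , ft′≈t₂ = mapTriple-lift ft≈t₁ t₁⊢t₂
            in from (∈-image (mapTriple i) (set A) t₂)
                 (t′ , closed A t∈A st , ft′≈t₂)
        }

      saturatedMap : Homomorphism C (saturatedAlgebra X) (saturatedAlgebra Y)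
      saturatedMap = record
        { func    = λ i → record
          { to   = saturatedImage
          ; cong = λ {A} {B} A≐B t →
              let imA = ∈-image (mapTriple i) (set A) t
                  imB = ∈-image (mapTriple i) (set B) t
              in mk⇔
                (λ t∈ → let t₁ , t₁∈A , p = to imA t∈
                        in from imB (t₁ , to (A≐B t₁) t₁∈A , p))
                (λ t∈ → let t₁ , t₁∈B , p = to imB t∈
                        in from imA (t₁ , from (A≐B t₁) t₁∈B , p))
          }
        ; natural = λ {i} {k} d A t₂ →
            let im   = ∈-image (mapTriple k) (set (act X d A)) t₂
                step = ∈-act Y d (saturatedImage A) t₂
            in mk⇔
              (λ t₂∈ →
                let t , t∈ , ft≈t₂  = to im t₂∈
                    t₁ , t₁∈A , st  = to (∈-act X d A t) t∈
                    ft₁             = Func.to (mapTriple i) t₁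
                in ∈-resp (set (act Y d (saturatedImage A))) ft≈t₂
                     (from (∈-act Y d (saturatedImage A) _)
                       (ft₁ ,
                        from (∈-image (mapTriple i) (set A) ft₁)
                          (t₁ , t₁∈A , Setoid.refl (triples Y i)) ,
                        mapTriple-⊢ {t₁ = t₁} {t} st)))
              (λ t₂∈ →
                let t₁ , t₁∈ , t₁⊢t₂ = to step t₂∈
                    t , t∈A , ft≈t₁  = to (∈-image (mapTriple i) (set A) t₁) t₁∈
                    t′ , st , ft′≈t₂ = mapTriple-lift ft≈t₁ t₁⊢t₂
                in from im (t′ , from (∈-act X d A t′) (t , t∈A , st) , ft′≈t₂))
        }

    S : Functor (Alg C) (Alg C)
    S = record
      { F₀     = saturatedAlgebra
      ; F₁     = saturatedMap
      ; F-cong = λ {X} {Y} {f} {g} f≈g i A t →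
          let fg : ∀ u → Setoid._≈_ (triples Y i)
                     (Func.to (mapTriple f i) u) (Func.to (mapTriple g i) u)
              fg = λ { (_ , _ , _ , k , x) →
                       inj (Hom.refl , O.refl , inj (f≈g k x)) }
              open Setoid (triples Y i) using (trans; sym)
          in mk⇔
            (λ { (n , p , eq) → n , p , trans (sym (fg _)) eq })
            (λ { (n , p , eq) → n , p , trans (fg _) eq })
      ; F-id   = λ X i A t → mk⇔ (λ p → p) (λ p → p)
      ; F-⨟    = λ f g i A t → mk⇔ (λ p → p) (λ p → p)
      }

module Submission where

open import Level using (Level; _⊔_; suc)
open import Data.Nat.Base using (ℕ)
open import Data.Product.Base using (Σ; ∃; ∃₂; _×_; _,_; proj₁; proj₂)
open import Data.Sum.Base using (_⊎_; inj₁; inj₂)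
open import Function.Bundles using (Func; _⇔_; mk⇔; Equivalence)
import Function.Properties.Equivalence as ⇔
open import Relation.Binary.Bundles using (Setoid)
open import Relation.Binary.PropositionalEquality.Core using (_≡_; refl)
open import Defs

-- The final coalgebra consists of pointed transition systems whose states
-- form a set in ℓ, modulo bisimilarity.  Two size problems are solved by the
-- same inductive-recursive type of paths: the part of a large coalgebra that
-- is reachable from a point is small, as every state has a small set of
-- successors, and so is the part of a large bisimulation that is reachable
-- from a related pair, once matching transitions are chosen.  The laws of a
-- coalgebra are imposed on a system only up to bisimilarity, because the
-- equality of a large coalgebra is large.

-- Small paths through a large family.

module Generated
  {a b} {I : Set a} {P : I → Set b}
  (A : ∀ {i} → P i → Set a) (next : ∀ {i} (x : P i) → A x → Σ I P)
  {i₀ : I} (x₀ : P i₀) where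

  -- Paths record moves only and `eval` computes the endpoint, so `Path` stays in `Set a` whatever
  -- the level `b` of `P`.
  data Path : I → Set a
  eval : ∀ {i} → Path i → P i

  data Path where
    root : Path i₀
    step : ∀ {i} (p : Path i) (y : A (eval p)) → Path (proj₁ (next (eval p) y))

  eval root       = x₀
  eval (step p y) = proj₂ (next (eval p) y)

-- Transition systems and bisimilarity.

module _ {ℓ : Level} (C : Category ℓ ℓ ℓ) (O : Setoid ℓ ℓ) where
  open Category C
  private
    module O = Setoid O
    variable
      p q r r′ : Level

  Transition : (Obj → Set p) → Obj → Set (ℓ ⊔ p)
  Transition P i = Σ Obj λ a → (i ⇒ a) × (O.Carrier × Σ Obj P)

  mapTransition : {P : Obj → Set p} {Q : Obj → Set q} → (∀ {i} → P i → Q i) →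
                  ∀ {i} → Transition P i → Transition Q i
  mapTransition f (a , c , o , k , x) = a , c , o , k , f x

  data Match {P : Obj → Set p} {Q : Obj → Set q} (R : ∀ i → P i → Q i → Set r)
             {i} : Transition P i → Transition Q i → Set (ℓ ⊔ p ⊔ q ⊔ r) where
    match : ∀ {a k} {c c′ : i ⇒ a} {o o′} {x : P k} {y : Q k} →
            c ≈ c′ → o O.≈ o′ → R k x y →
            Match R (a , c , o , k , x) (a , c′ , o′ , k , y)

  record System : Set (suc ℓ) where
    infixl 8 _▹_
    field
      State : Obj → Set ℓ
      _▹_   : ∀ {i j} → State i → i ⇒ j → State j
      Dom   : ∀ {i} → State i → ℕ → Set ℓ
      out   : ∀ {i} (s : State i) n → Dom s n → Transition State i

  module _ (M N : System) where
    private
      module M = System M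
      module N = System N

    record IsBisimulation (R : ∀ i → M.State i → N.State i → Set r) :
                          Set (ℓ ⊔ r) where
      field
        ▹-related : ∀ {i j s t} → R i s t → (c : i ⇒ j) → R j (s M.▹ c) (t N.▹ c)
        forth     : ∀ {i s t} → R i s t → ∀ n (p : M.Dom s n) →
                    ∃₂ λ m (q : N.Dom t m) → Match R (M.out s n p) (N.out t m q)
        back      : ∀ {i s t} → R i s t → ∀ m (q : N.Dom t m) →
                    ∃₂ λ n (p : M.Dom s n) → Match R (M.out s n p) (N.out t m q)

    -- Quantifying only over relations in `Set ℓ` keeps this type in `Set (suc ℓ)`, where it can be
    -- the equality of a sort. `bisimulation⇒bisimilar` lifts the restriction.
    record Bisimilar {i} (s : M.State i) (t : N.State i) : Set (suc ℓ) where
      field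
        relation       : ∀ i → M.State i → N.State i → Set ℓ
        isBisimulation : IsBisimulation relation
        related        : relation i s t

    open IsBisimulation
    open Bisimilar

    private
      relate : {R : ∀ i → M.State i → N.State i → Set r}
               {R′ : ∀ i → M.State i → N.State i → Set r′} →
               (∀ {i s t} → R i s t → R′ i s t) →
               ∀ {i u v} → Match R {i} u v → Match R′ u v
      relate f (match c≈ o≈ xRy) = match c≈ o≈ (f xRy)

    -- A move is answered inside the relation that witnesses the pair, and `within` reuses that
    -- relation for the successors.
    Bisimilar-isBisimulation : IsBisimulation λ i → Bisimilar {i}
    Bisimilar-isBisimulation = record
      { ▹-related = λ s∼t c →
          within s∼t (▹-related (isBisimulation s∼t) (related s∼t) c)
      ; forth     = λ s∼t n p →
          let m , q , u = forth (isBisimulation s∼t) (related s∼t) n p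
          in m , q , relate (within s∼t) u
      ; back      = λ s∼t m q →
          let n , p , u = back (isBisimulation s∼t) (related s∼t) m q
          in n , p , relate (within s∼t) u
      }
      where
      within : ∀ {i j} {s : M.State i} {t : N.State i}
               {s′ : M.State j} {t′ : N.State j} (s∼t : Bisimilar s t) →
               relation s∼t j s′ t′ → Bisimilar s′ t′
      within s∼t s′Rt′ = record
        { relation       = relation s∼t
        ; isBisimulation = isBisimulation s∼t
        ; related        = s′Rt′
        }

    module _ {R : ∀ i → M.State i → N.State i → Set r}
             (B : IsBisimulation R) where
      private
        Index : Set ℓ
        Index = Σ Obj λ i → M.State i × N.State i

        R′ : Index → Set _
        R′ (i , s , t) = R i s t

        Move : ∀ {x} → R′ x → Set ℓ
        Move {i , s , t} _ = (Σ Obj λ j → i ⇒ j) ⊎ (∃ (M.Dom s) ⊎ ∃ (N.Dom t))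

        targets : ∀ {i} {u : Transition M.State i} {v : Transition N.State i} →
                  Match R u v → Σ Index R′
        targets (match _ _ xRy) = _ , xRy

        next : ∀ {x} (xR : R′ x) → Move xR → Σ Index R′
        next sRt (inj₁ (j , c))        = _ , ▹-related B sRt c
        next sRt (inj₂ (inj₁ (n , p))) = targets (proj₂ (proj₂ (forth B sRt n p)))
        next sRt (inj₂ (inj₂ (m , q))) = targets (proj₂ (proj₂ (back B sRt m q)))

      -- With `forth` and `back` read as choices of answers, a related pair has a small type of
      -- moves. The pairs reached from `sRt` by such moves form a bisimulation in `Set ℓ`, since
      -- each answer is one more step of a path.
      bisimulation⇒bisimilar : ∀ {i} {s : M.State i} {t : N.State i} →
                               R i s t → Bisimilar s t
      bisimulation⇒bisimilar {i} {s} {t} sRt = record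
        { relation       = R₀
        ; isBisimulation = record
          { ▹-related = λ w c → step w (inj₁ (_ , c))
          ; forth     = λ w n p → _ , _ ,
              small (proj₂ (proj₂ (forth B (eval w) n p)))
                    (step w (inj₂ (inj₁ (n , p))))
          ; back      = λ w m q → _ , _ ,
              small (proj₂ (proj₂ (back B (eval w) m q)))
                    (step w (inj₂ (inj₂ (m , q))))
          }
        ; related        = root
        }
        where
        open Generated {P = R′} (λ {x} → Move {x}) (λ {x} → next {x})
                       {i , s , t} sRt

        R₀ : ∀ j → M.State j → N.State j → Set ℓ
        R₀ j s t = Path (j , s , t)

        -- The match is an argument so that splitting on it reduces `targets w`.
        small : ∀ {j} {u : Transition M.State j} {v : Transition N.State j}
                (w : Match R u v) → Path (proj₁ (targets w)) → Match R₀ u v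
        small (match c≈ o≈ _) path = match c≈ o≈ path

  open IsBisimulation
  open Bisimilar

  -- Bisimilarity as an equivalence across systems.

  ∼-refl : ∀ {M i} {s : System.State M i} → Bisimilar M M s s
  ∼-refl {M} = bisimulation⇒bisimilar M M {R = λ i → _≡_} record
    { ▹-related = λ { refl c → refl }
    ; forth     = λ { refl n p → n , p , match Hom.refl O.refl refl }
    ; back      = λ { refl n p → n , p , match Hom.refl O.refl refl }
    } refl

  ∼-sym : ∀ {M N i} {s : System.State M i} {t : System.State N i} →
          Bisimilar M N s t → Bisimilar N M t s
  ∼-sym {M} {N} s∼t = bisimulation⇒bisimilar N M
    {R = λ i t s → Bisimilar M N s t} record
    { ▹-related = ▹-related B
    ; forth     = λ t∼s m q → let n , p , u = back B t∼s m q in n , p , converse u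
    ; back      = λ t∼s n p → let m , q , u = forth B t∼s n p in m , q , converse u
    } s∼t
    where
    B = Bisimilar-isBisimulation M N

    converse : ∀ {i u v} → Match (λ i → Bisimilar M N {i}) {i} u v →
               Match (λ i t s → Bisimilar M N {i} s t) v u
    converse (match c≈ o≈ x∼y) = match (Hom.sym c≈) (O.sym o≈) x∼y

  -- Answers are threaded through the middle system. The composite relation is large and is cut down
  -- by `bisimulation⇒bisimilar`.
  ∼-trans : ∀ {L M N i} {s : System.State L i} {t : System.State M i}
            {u : System.State N i} →
            Bisimilar L M s t → Bisimilar M N t u → Bisimilar L N s u
  ∼-trans {L} {M} {N} s∼t t∼u = bisimulation⇒bisimilar L N {R = R} record
    { ▹-related = λ (_ , s∼t , t∼u) c →
        _ , ▹-related B s∼t c , ▹-related B′ t∼u c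
    ; forth     = λ (_ , s∼t , t∼u) n p →
        let n′ , p′ , w  = forth B s∼t n p
            n″ , p″ , w′ = forth B′ t∼u n′ p′
        in n″ , p″ , comp w w′
    ; back      = λ (_ , s∼t , t∼u) n p →
        let n′ , p′ , w  = back B′ t∼u n p
            n″ , p″ , w′ = back B s∼t n′ p′
        in n″ , p″ , comp w′ w
    } (_ , s∼t , t∼u)
    where
    B  = Bisimilar-isBisimulation L M
    B′ = Bisimilar-isBisimulation M N

    R : ∀ i → System.State L i → System.State N i → Set (suc ℓ)
    R i s u = ∃ λ t → Bisimilar L M s t × Bisimilar M N t u

    comp : ∀ {i u v w} → Match (λ i → Bisimilar L M {i}) {i} u v →
           Match (λ i → Bisimilar M N {i}) v w → Match R u w
    comp (match c≈ o≈ x∼y) (match c≈′ o≈′ y∼z) =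
      match (Hom.trans c≈ c≈′) (O.trans o≈ o≈′) (_ , x∼y , y∼z)

-- Lawful systems and the algebra of their states.

module _ {ℓ : Level} (C : Category ℓ ℓ ℓ) (countable : CountablyManyArrows C)
         (O : Setoid ℓ ℓ) (T : InferenceSystem C O) where
  open Category C
  private
    module O = Setoid O
    module Alg = Category (Alg C)

  -- The argument T is elaborated to λ {i i′ j j′} → T {i} {i′} {j} {j′}, which
  -- is η-contracted only once a definition is complete.  Types that mention T
  -- are therefore named, here and in SaturatedCoalgFinal: if written out twice,
  -- they would be compared by unfolding all of S.
  SatFunctor : Functor (Alg C) (Alg C)
  SatFunctor = S C O T countable

  open Functor SatFunctor

  Structure : Algebra C → Set (suc ℓ)
  Structure X = X Alg.⇒ F₀ X

  -- The last two laws say that s ▹ d has exactly the transitions of the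
  -- d-image of the set of transitions of s.
  record LawfulSystem : Set (suc ℓ) where
    field
      system : System C O
    open System system public

    infix 4 _∼_ _∈out_
    _∼_ : ∀ {i} → State i → State i → Set (suc ℓ)
    _∼_ = Bisimilar C O system system

    _∈out_ : ∀ {i} → Transition C O State i → State i → Set (suc ℓ)
    u ∈out s = ∃₂ λ n (p : Dom s n) → Match C O (λ _ → _∼_) (out s n p) u

    field
      ▹-cong     : ∀ {i j} {c c′ : i ⇒ j} → c ≈ c′ → ∀ s → s ▹ c ∼ s ▹ c′
      ▹-id       : ∀ {i} (s : State i) → s ▹ id i ∼ s
      ▹-⨟        : ∀ {i j k} (d : i ⇒ j) (f : j ⇒ k) s → s ▹ (d ⨟ f) ∼ s ▹ d ▹ f
      out-irr    : ∀ {i} (s : State i) n p q →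
                   Match C O (λ _ → _∼_) (out s n p) (out s n q)
      out-closed : ∀ {i} (s : State i) n p →
                   let a , c , o , k , x = out s n p in
                   ∀ {b j o′} {e : a ⇒ b} {e′ : k ⇒ j} → Φ C O T e o o′ e′ →
                   (b , c ⨟ e , o′ , j , x ▹ e′) ∈out s
      out-▹      : ∀ {i j} (s : State i) (d : i ⇒ j) n p →
                   let a , c , o , k , x = out (s ▹ d) n p in
                   (a , d ⨟ c , o , k , x) ∈out s
      ▹-out      : ∀ {i j} (s : State i) (d : i ⇒ j) n p →
                   let a , c , o , k , x = out s n p in
                   ∀ {c′} → c ≈ d ⨟ c′ → (a , c′ , o , k , x) ∈out (s ▹ d)

  open Equivalence using (to; from)
  open IsBisimulation

  -- Saturation makes the inference steps in the action superfluous.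
  ∈-act-⨟ : (X : Algebra C) → ∀ {i k} (d : i ⇒ k) (A : Saturated C O T X i)
    {a c o j x} →
    (a , c , o , j , x) ∈ Saturated.set (act C O T countable X d A) ⇔
    (a , d ⨟ c , o , j , x) ∈ Saturated.set A
  ∈-act-⨟ X d A {a} {c} {o} {j} {x} = mk⇔
    (λ t∈ →
      let t , t∈A , e , e′ , eq , φ , r = to (∈-act C O T countable X d A _) t∈
      in Saturated.closed A t∈A
           (e , e′ , Hom.trans eq (Hom.sym (idˡ _)) , φ , r))
    (λ t∈A → from (∈-act C O T countable X d A _)
      ((a , d ⨟ c , o , j , x) , t∈A , ⊢-cancel C O T X Hom.refl))

  -- `LawfulSystem` and bisimilarity both lie in `Set (suc ℓ)`, the level of the sorts of an
  -- algebra. An arrow moves the point within its system, so the algebra laws are the laws of `▹`.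
  finalAlgebra : Algebra C
  finalAlgebra = record
    { sort    = λ i → record
      { Carrier       = Σ LawfulSystem λ M → LawfulSystem.State M i
      ; _≈_           = λ (M , s) (N , t) →
          Bisimilar C O (system M) (system N) s t
      ; isEquivalence = record
        { refl = ∼-refl C O ; sym = ∼-sym C O ; trans = ∼-trans C O }
      }
    ; op      = λ c → record
      { to   = λ (M , s) → M , LawfulSystem._▹_ M s c
      ; cong = λ s∼t → ▹-related (Bisimilar-isBisimulation C O _ _) s∼t c
      }
    ; op-cong = λ c≈c′ (M , s) → ▹-cong M c≈c′ s
    ; op-id   = λ (M , s) → ▹-id M s
    ; op-⨟    = λ d f (M , s) → ▹-⨟ M d f s
    }
    where open LawfulSystem

  private
    Z = finalAlgebra
    module Z = Algebra Z

  point : ∀ M {i} → Transition C O (LawfulSystem.State M) i → Triple C O T Z i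
  point M = mapTransition C O (M ,_)

  point-≈ : ∀ M N {i u v} →
    Match C O (λ i s t → (M , s) Z.Sort.≈ (N , t)) {i} u v →
    Setoid._≈_ (triples C O T Z i) (point M u) (point N v)
  point-≈ M N (match c≈ o≈ x∼y) = inj (c≈ , o≈ , inj x∼y)

  -- The saturated set of transitions of a state.

  module _ (M : LawfulSystem) where
    open LawfulSystem M

    outSet : ∀ {i} → State i → G C O T Z i
    outSet s = record
      { Dom     = Dom s
      ; elt     = λ n p → point M (out s n p)
      ; elt-irr = λ n p q → point-≈ M M (out-irr s n p q)
      }

    ∈-outSet : ∀ {i u} {s : State i} → u ∈out s → point M u ∈ outSet s
    ∈-outSet (n , p , w) = n , p , point-≈ M M w

    saturatedOut : ∀ {i} → State i → Saturated C O T Z i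
    saturatedOut s = record
      { set    = outSet s
      ; closed = λ { {t₂ = _ , _ , _ , _ , _ , _}
          (n , p , inj (c≈ , o≈ , inj x∼)) (e , e′ , eq , φ , r) →
          -- The given member may point into another system. The rule is applied to the listed
          -- transition of `M`, and `▹-related` compares the two results of `e′`.
          ∈-resp (outSet s)
            (inj (Hom.trans (⨟-cong c≈ Hom.refl) (Hom.trans eq (idˡ _)) ,
                  O.refl ,
                  inj (∼-trans C O
                    (▹-related (Bisimilar-isBisimulation C O _ _) x∼ e′) r)))
            (∈-outSet (out-closed s n p
              (resp Hom.refl (O.sym o≈) O.refl Hom.refl φ))) }
      }

    ∈-outSet-▹ : ∀ {i j} (d : i ⇒ j) (s : State i) {a c o k x} →
      (a , c , o , k , x) ∈ outSet (s ▹ d) ⇔ (a , d ⨟ c , o , k , x) ∈ outSet s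
    ∈-outSet-▹ d s = mk⇔
      (λ { (n , p , inj (c≈ , o≈ , inj x∼)) →
        ∈-resp (outSet s) (inj (⨟-cong Hom.refl c≈ , o≈ , inj x∼))
          (∈-outSet (out-▹ s d n p)) })
      (λ { (n , p , inj (c≈ , o≈ , inj x∼)) →
        ∈-resp (outSet (s ▹ d)) (inj (Hom.refl , o≈ , inj x∼))
          (∈-outSet (▹-out s d n p c≈)) })

    -- At a triple with arrow `c`, both sides reduce to membership in `outSet s` of the triple with
    -- arrow `d ⨟ c`: the left by `out-▹` and `▹-out`, the right by saturation.
    saturatedOut-natural : ∀ {i j} (d : i ⇒ j) (s : State i) →
      outSet (s ▹ d) ≐ Saturated.set (act C O T countable Z d (saturatedOut s))
    saturatedOut-natural d s _ =
      ⇔.trans (∈-outSet-▹ d s) (⇔.sym (∈-act-⨟ Z d (saturatedOut s)))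

  -- The reachable part of a coalgebra.

  module _ (X : Algebra C) (α : Structure X) where
    private
      module X = Algebra X
      module α = Homomorphism α

    transitions : ∀ {i} → X.El i → G C O T X i
    transitions x = Saturated.set (α.⟦_⟧ x)

    Index : ∀ {i} → X.El i → ℕ → Set ℓ
    Index x = CountableSubset.Dom (transitions x)

    transitionAt : ∀ {i} (x : X.El i) n → Index x n → Triple C O T X i
    transitionAt x = CountableSubset.elt (transitions x)

    private
      -- Arrows and the indices of a countable subset lie in `Set ℓ`, so the moves are small
      -- although `X.El` is not.
      Move : ∀ {i} → X.El i → Set ℓ
      Move {i} x = (Σ Obj λ j → i ⇒ j) ⊎ ∃ (Index x)

      next : ∀ {i} (x : X.El i) → Move x → Σ Obj X.El
      next x (inj₁ (j , c)) = j , x X.· c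
      next x (inj₂ (n , p)) = let _ , _ , _ , y = transitionAt x n p in y

    module Reachable {i₀} (x₀ : X.El i₀) where
      open Generated {P = X.El} Move next x₀ public
      open System using (State; _▹_; Dom; out)

      -- With paths as states, acting and following a transition both extend the path, and `eval`
      -- commutes with them definitionally.
      reachable : System C O
      State reachable       = Path
      _▹_   reachable s c   = step s (inj₁ (_ , c))
      Dom   reachable s     = Index (eval s)
      out   reachable s n p =
        let a , c , o , _ = transitionAt (eval s) n p
        in a , c , o , _ , step s (inj₂ (n , p))

    open Reachable using (Path; root; eval; reachable)

    private
      match-eval : ∀ {i₀ j₀} {x₀ : X.El i₀} {y₀ : X.El j₀} {r}
        {R : ∀ i → Path x₀ i → Path y₀ i → Set r} →
        (∀ {i s t} → eval x₀ s X.Sort.≈ eval y₀ t → R i s t) →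
        ∀ {i u v} →
        Setoid._≈_ (triples C O T X i)
          (mapTransition C O (eval x₀) u) (mapTransition C O (eval y₀) v) →
        Match C O R {i} u v
      match-eval f {u = _ , _ , _ , _ , _} {_ , _ , _ , _ , _}
        (inj (c≈ , o≈ , inj x≈)) = match c≈ o≈ (f x≈)

    -- Equality of values is a large bisimulation, because `α` and the operations of `X` respect it.
    -- The starting points may differ, so this also compares reachable parts with each other.
    eval-≈⇒∼ : ∀ {i₀ j₀} {x₀ : X.El i₀} {y₀ : X.El j₀}
      {i} {s : Path x₀ i} {t : Path y₀ i} →
      eval x₀ s X.Sort.≈ eval y₀ t →
      Bisimilar C O (reachable x₀) (reachable y₀) s t
    eval-≈⇒∼ {x₀ = x₀} {y₀} = bisimulation⇒bisimilar C O _ _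
      {R = λ i s t → eval x₀ s X.Sort.≈ eval y₀ t} record
      { ▹-related = λ s≈t c → Func.cong (X.op c) s≈t
      ; forth     = λ {_} {s} {t} s≈t n p →
          let m , q , eq = to (Func.cong (α.func _) s≈t _)
                             (∈-elt (transitions (eval x₀ s)) n p)
          in m , q , match-eval (λ e → e) (Setoid.sym (triples C O T X _) eq)
      ; back      = λ {_} {s} {t} s≈t m q →
          let n , p , eq = from (Func.cong (α.func _) s≈t _)
                             (∈-elt (transitions (eval y₀ t)) m q)
          in n , p , match-eval (λ e → e) eq
      }

    -- Each law holds for the values, by the algebra laws, saturation or naturality of `α`;
    -- `eval-≈⇒∼` turns equal values into bisimilar states.
    reachableLawful : ∀ {i₀} → X.El i₀ → LawfulSystem
    reachableLawful x₀ = record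
      { system     = reachable x₀
      ; ▹-cong     = λ c≈c′ s → eval-≈⇒∼ (X.op-cong c≈c′ (ev s))
      ; ▹-id       = λ s → eval-≈⇒∼ (X.op-id (ev s))
      ; ▹-⨟        = λ d f s → eval-≈⇒∼ (X.op-⨟ d f (ev s))
      ; out-irr    = λ s n p q →
          match-eval eval-≈⇒∼ (CountableSubset.elt-irr (transitions (ev s)) n p q)
      ; out-closed = λ s n p φ → ∈out s
          (Saturated.closed (α.⟦_⟧ (ev s)) (∈-elt (transitions (ev s)) n p)
            (_ , _ , Hom.sym (idˡ _) , φ , X.Sort.refl))
      ; out-▹      = λ s d n p → ∈out s
          (to (∈-act-⨟ X d (α.⟦_⟧ (ev s)))
            (to (α.natural d (ev s) _)
              (∈-elt (transitions (ev s X.· d)) n p)))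
      ; ▹-out      = λ s d n p c≈ → ∈out (step s (inj₁ (_ , d)))
          (from (α.natural d (ev s) _)
            (from (∈-act-⨟ X d (α.⟦_⟧ (ev s)))
              (∈-resp (transitions (ev s)) (inj (c≈ , O.refl , inj X.Sort.refl))
                (∈-elt (transitions (ev s)) n p))))
      }
      where
      open Reachable x₀ using (step)

      ev : ∀ {i} → Path x₀ i → X.El i
      ev = eval x₀

      ∈out : ∀ {i} (s : Path x₀ i) {u} →
        mapTransition C O ev u ∈ transitions (ev s) →
        ∃₂ λ n p → Match C O (λ _ → Bisimilar C O (reachable x₀) (reachable x₀))
                     (System.out (reachable x₀) s n p) u
      ∈out s (n , p , eq) = n , p , match-eval eval-≈⇒∼ eq

  -- The structure map on the final algebra.

  finalStructure : Structure Z
  finalStructure = record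
    { func    = λ i → record
      { to   = λ (M , s) → saturatedOut M s
      ; cong = λ {(M , s)} {(N , t)} s∼t u →
          mk⇔ (transfer M N s∼t) (transfer N M (∼-sym C O s∼t))
      }
    ; natural = λ d (M , s) → saturatedOut-natural M d s
    }
    where
    open LawfulSystem
    transfer : ∀ M N {i} {s : State M i} {t : State N i} →
      Bisimilar C O (system M) (system N) s t →
      ∀ {u} → u ∈ outSet M s → u ∈ outSet N t
    transfer M N {t = t} s∼t (n , p , eq) =
      let m , q , w = forth (Bisimilar-isBisimulation C O _ _) s∼t n p
      in ∈-resp (outSet N t) eq
           (m , q , Setoid.sym (triples C O T Z _) (point-≈ M N w))

  -- The unique morphism into the final coalgebra.

  module _ (X : Algebra C) (α : Structure X) where
    private module X = Algebra X
    open Reachable X α using (root; step; eval; reachable)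

    -- Each element becomes the root of its own reachable part. Naturality therefore compares two
    -- systems, at states that both evaluate to `x X.· c`.
    behaviour : Homomorphism C X Z
    behaviour = record
      { func    = λ i → record
        { to   = λ x → reachableLawful X α x , root
        ; cong = eval-≈⇒∼ X α {s = root} {root}
        }
      ; natural = λ c x →
          eval-≈⇒∼ X α {s = root} {step root (inj₁ (_ , c))}
            X.Sort.refl
      }

    open Homomorphism behaviour using (⟦_⟧)

    behaviour-target : ∀ {i} (x : X.El i) n p →
      let _ , _ , _ , _ , y = transitionAt X α x n p in
      ⟦ y ⟧ Z.Sort.≈ (reachableLawful X α x , step root (inj₂ (n , p)))
    behaviour-target x n p =
      eval-≈⇒∼ X α {s = root} {step root (inj₂ (n , p))} X.Sort.refl

    CommutesWithOut : Homomorphism C X Z → Set (suc ℓ)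
    CommutesWithOut f = α Alg.⨟ F₁ f Alg.≈ f Alg.⨟ finalStructure

    behaviour-commutes : CommutesWithOut behaviour
    behaviour-commutes i x t = mk⇔
      -- Both sets are enumerated by `Index X α x`, so the index is kept; only the targets differ,
      -- and `behaviour-target` relates them.
      (λ { (n , p , inj (c≈ , o≈ , inj x∼)) → n , p ,
        inj (c≈ , o≈ ,
             inj (∼-trans C O (∼-sym C O (behaviour-target x n p)) x∼)) })
      (λ { (n , p , inj (c≈ , o≈ , inj x∼)) → n , p ,
        inj (c≈ , o≈ , inj (∼-trans C O (behaviour-target x n p) x∼)) })

    module _ (f : Homomorphism C X Z) (commutes : CommutesWithOut f)
             {i₀} (x₀ : X.El i₀) where
      open LawfulSystem using (State; system; _▹_)
      private
        module f = Homomorphism f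
        module ζ = Homomorphism finalStructure

        M : LawfulSystem
        M = proj₁ (f.⟦_⟧ x₀)

        Path : Obj → Set ℓ
        Path = Reachable.Path X α x₀

        ev : ∀ {i} → Path i → X.El i
        ev = eval x₀

        -- `f` may send each `ev t` into a different system, while `s` ranges over the system of
        -- `f.⟦_⟧ x₀` alone; hence the comparison in `Z`.
        R : ∀ i → State M i → Path i → Set (suc ℓ)
        R i s t = (M , s) Z.Sort.≈ f.⟦_⟧ (ev t)

        R-▹ : ∀ {i j s t} → R i s t → (c : i ⇒ j) →
              R j (_▹_ M s c) (step t (inj₁ (_ , c)))
        R-▹ {t = t} s∼ft c = ∼-trans C O
          (▹-related (Bisimilar-isBisimulation C O _ _) s∼ft c)
          (∼-sym C O (f.natural c (ev t)))

        -- As `f` is a coalgebra morphism, the image is the value of `finalStructure` at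
        -- `f.⟦_⟧ (ev t)`, and `finalStructure` respects bisimilarity.
        ∈-related : ∀ {i s t} → R i s t → ∀ u →
          u ∈ image (mapTriple C O T countable f i) (transitions X α (ev t)) ⇔
          u ∈ outSet M s
        ∈-related {t = t} s∼ft u =
          ⇔.trans (commutes _ (ev t) u) (⇔.sym (Func.cong (ζ.func _) s∼ft u))

        related : ∀ {i u v} → Setoid._≈_ (triples C O T Z i)
          (point M u) (mapTransition C O (λ t → f.⟦_⟧ (ev t)) v) →
          Match C O R u v
        related {u = _ , _ , _ , _ , _} {_ , _ , _ , _ , _}
          (inj (c≈ , o≈ , inj x∼)) = match c≈ o≈ x∼

        related-isBisimulation : IsBisimulation C O (system M) (reachable x₀) R
        related-isBisimulation = record
          { ▹-related = λ {_} {_} {s} {t} → R-▹ {s = s} {t}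
          ; forth     = λ {_} {s} {t} s∼ft n p →
              let m , q , eq = from (∈-related {s = s} {t} s∼ft _)
                    (∈-elt (outSet M s) n p)
              in m , q , related (Setoid.sym (triples C O T Z _) eq)
          ; back      = λ {_} {s} {t} s∼ft m q →
              let n , p , eq = to (∈-related {s = s} {t} s∼ft _)
                    (m , q , Setoid.refl (triples C O T Z _))
              in n , p , related eq
          }

      behaviour-unique : f.⟦_⟧ x₀ Z.Sort.≈ ⟦ x₀ ⟧
      behaviour-unique = bisimulation⇒bisimilar C O (system M) (reachable x₀)
        -- The initial pair is related by reflexivity: `M` with its point is `f.⟦_⟧ x₀` itself.
        related-isBisimulation (∼-refl C O)

  finalCoalgebra : Coalgebra SatFunctor
  finalCoalgebra = record { carrier = Z ; structure = finalStructure }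

  SaturatedCoalgFinal : Set (suc (suc ℓ))
  SaturatedCoalgFinal = FinalObject (Coalg (S C O T countable))

  saturatedCoalgFinal : SaturatedCoalgFinal
  saturatedCoalgFinal = record
    { final    = finalCoalgebra
    ; !        = λ X → record
      { arrow    = behaviour (carrier X) (structure X)
      ; commutes = behaviour-commutes (carrier X) (structure X)
      }
    ; !-unique = λ {X} f i →
        behaviour-unique (carrier X) (structure X) (arrow f) (commutes f)
    }
    where
    open Coalgebra
    open CoalgebraHom

corollaryD7 : ∀ {ℓ : Level} (C : Category ℓ ℓ ℓ) (countable : CountablyManyArrows C) (O : Setoid ℓ ℓ) (T : InferenceSystem C O) → FinalObject (Coalg (S C O T countable))
corollaryD7 = saturatedCoalgFinal
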